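{- Consider the transversal achievement game on the $n\times n$ board. The first player wins (i.e. has a winning strategy) for $n=1$ and for every $n\ge 4$; for $n=2$ and $n=3$ the game is a draw (i.e. neither player has a winning strategy).
   Context: Transversal achievement game on the $n\times n$ board ($n\ge1$): two players alternately claim previously unclaimed cells of an $n\times n$ grid; Player 1 (called X) moves first, Player 2 is called O. A transversal is a set of $n$ cells of which no two share a row or a column. The first player to own a set of cells containing a transversal wins. If neither player ever does so (the board fills up), the game is a draw. -}

module Defs where

open import Data.Fin.Base using (Fin)
open import Data.List.Base using (List; []; _∷_; length)
open import Data.List.Membership.Propositional using (_∈_; _∉_)
open import Data.List.Relation.Binary.Subset.Propositional using (_⊆_)
open import Data.List.Relation.Unary.AllPairs using (AllPairs)
open import Data.Nat.Base using (ℕ)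
open import Data.Product.Base using (_×_; ∃-syntax; proj₁; proj₂)
open import Data.Sum.Base using (_⊎_)
open import Data.Unit.Base using (⊤)
open import Relation.Binary.PropositionalEquality using (_≡_; _≢_)
open import Relation.Nullary.Negation using (¬_)

data Player : Set where
  X O : Player

opponent : Player → Player
opponent X = O
opponent O = X

Cell : ℕ → Set
Cell n = Fin n × Fin n

row col : {n : ℕ} → Cell n → Fin n
row = proj₁
col = proj₂

-- The cells claimed so far, most recent first.
History : ℕ → Set
History n = List (Cell n)

toMove : {n : ℕ} → History n → Player
toMove []      = X
toMove (c ∷ h) = opponent (toMove h)

cellsOf : {n : ℕ} → Player → History n → List (Cell n)
cellsOf p []      = []
cellsOf p (c ∷ h) with p | toMove h
... | X | X = c ∷ cellsOf p h
... | O | O = c ∷ cellsOf p h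
... | X | O = cellsOf p h
... | O | X = cellsOf p h

-- The second condition already forces the listed cells to be distinct,
-- so such a list enumerates a set of exactly n cells.
IsTransversal : {n : ℕ} → List (Cell n) → Set
IsTransversal {n} t =
  length t ≡ n × AllPairs (λ c d → row c ≢ row d × col c ≢ col d) t

OwnsTransversal : {n : ℕ} → Player → History n → Set
OwnsTransversal {n} p h = ∃[ t ] (IsTransversal {n} t × t ⊆ cellsOf p h)

BoardFull : {n : ℕ} → History n → Set
BoardFull {n} h = (c : Cell n) → c ∈ h

Over : {n : ℕ} → History n → Set
Over h = OwnsTransversal X h ⊎ OwnsTransversal O h ⊎ BoardFull h

-- Play stops once a player owns a transversal, so in a play whoever owns
-- one is the first to do so.
data Play {n : ℕ} : History n → Set where
  start : Play []
  move  : {h : History n} {c : Cell n} →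
          Play h → ¬ Over h → c ∉ h → Play (c ∷ h)

Strategy : ℕ → Set
Strategy n = History n → Cell n

Follows : {n : ℕ} → Player → Strategy n → History n → Set
Follows p σ []      = ⊤
Follows p σ (c ∷ h) = (toMove h ≡ p → c ≡ σ h) × Follows p σ h

-- Strategies are arbitrary functions, so legality of the prescribed moves is
-- required separately. Every play reaches an Over position after at most n * n
-- moves; one that ends with a full board and no transversal violates wins.
record IsWinning {n : ℕ} (p : Player) (σ : Strategy n) : Set where
  field
    legal : (h : History n) → Play h → Follows p σ h →
            ¬ Over h → toMove h ≡ p → σ h ∉ h
    wins  : (h : History n) → Play h → Follows p σ h →
            Over h → OwnsTransversal p h

HasWinningStrategy : Player → ℕ → Set
HasWinningStrategy p n = ∃[ σ ] IsWinning {n} p σ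

IsDraw : ℕ → Set
IsDraw n = ¬ HasWinningStrategy X n × ¬ HasWinningStrategy O n

{-# OPTIONS --safe #-}

-- For n ≥ 4, X first builds a matching greedily: up to renaming lines she owns the
-- diagonal cells (i , i) with i ≥ k, and she picks each new cell so that among the
-- rows and columns below k only one, z, meets a cell of O, and only one such cell.
-- (If O wasted a move by doubling up a line, z may meet none.) At k = 1 she needs only
-- (0 , 0), which O must take, and by then two cells of O share a column or a row, say
-- a column. Let u be a row without cells of O. X plays (0 , u), threatening (u , 0);
-- after O's reply there she plays (w , 0), threatening (0 , w) and (u , w) at once.
-- As the forced replies (0 , 0) and (u , 0) share a column too, O's cells never meet
-- all n columns before X has won.
--
-- For n = 2 and n = 3, a search of the game tree finds a foiling line of play against
-- each strategy.
module Submission where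

open import Data.Empty using (⊥)
open import Data.Fin.Base using (Fin; zero; suc; toℕ; fromℕ; fromℕ<)
open import Data.Fin.Permutation.Components using (transpose)
open import Data.Fin.Properties using (toℕ-injective; toℕ-fromℕ<; toℕ-fromℕ; toℕ≤pred[n]; ¬∀⟶∃¬)
  renaming (_≟_ to _≟ᶠ_; all? to allFin?)
open import Data.List.Base using (List; []; _∷_; length; filter; map; tabulate)
open import Data.List.Membership.Propositional using (_∈_; _∉_; find; lose)
open import Data.List.Membership.Propositional.Properties
  using (∈-filter⁺; ∈-filter⁻; ∈-map⁺; ∈-map⁻; ∈-tabulate⁻)
import Data.List.Membership.DecPropositional as DecMembership
open import Data.List.Properties using (length-map; length-tabulate; map-∘; map-cong; map-id; filter-notAll)
open import Data.List.Relation.Binary.Subset.Propositional using (_⊆_)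
import Data.List.Relation.Binary.Subset.Propositional.Properties as Subset
open import Data.List.Relation.Unary.All as All using ([]; _∷_)
open import Data.List.Relation.Unary.AllPairs as AllPairs using (AllPairs; []; _∷_)
import Data.List.Relation.Unary.AllPairs.Properties as AllPairs
open import Data.List.Relation.Unary.Any using (Any; here; there; any?)
open import Data.List.Relation.Unary.Unique.Propositional using (Unique)
open import Data.List.Relation.Unary.Unique.Propositional.Properties using (allFin⁺)
open import Data.Maybe.Base as Maybe using (Maybe; just; nothing; maybe; from-just; _<∣>_)
open import Data.Nat.Base using (ℕ; zero; suc; _+_; _≤_; _<_; _≥_; z≤n; s≤s; z<s; s<s)
open import Data.Nat.Properties
  using (≤-trans; ≤-refl; ≤∧≢⇒<; <⇒≢; <⇒≱; _<?_; m<n⇒m<1+n; m<1+n⇒m≤n; m≤m+n; m≤n+m; n<1+n; +-suc; +-comm;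
         suc-injective)
open import Data.Product.Base using (_×_; _,_; ∃-syntax; proj₁; proj₂; uncurry; swap)
open import Data.Product.Properties using (≡-dec)
open import Data.Sum.Base as Sum using (_⊎_; inj₁; inj₂)
open import Data.Unit.Base using (tt)
open import Function.Base using (_∘_; const)
open import Relation.Binary.PropositionalEquality
  using (_≡_; _≢_; refl; sym; trans; cong; cong₂; subst; subst₂; ≢-sym)
open import Relation.Nullary.Decidable using (Dec; yes; no; map′; ¬?; _×-dec_; _⊎-dec_; dec-true; dec-false)
open import Relation.Nullary.Negation using (¬_; contradiction)
open import Defs

private
  variable
    n k b : ℕ
    p     : Player
    h     : History n
    xs os : List (Cell n)

-- Deciding whether a play is over.

Apart : Cell n → Cell n → Set
Apart c d = row c ≢ row d × col c ≢ col d

apart? : (c d : Cell n) → Dec (Apart c d)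
apart? c d = ¬? (row c ≟ᶠ row d) ×-dec ¬? (col c ≟ᶠ col d)

_≟ᶜ_ : (c d : Cell n) → Dec (c ≡ d)
_≟ᶜ_ = ≡-dec _≟ᶠ_ _≟ᶠ_

_∈?_ : (c : Cell n) (xs : List (Cell n)) → Dec (c ∈ xs)
_∈?_ = DecMembership._∈?_ _≟ᶜ_

_≟ᵖ_ : (p q : Player) → Dec (p ≡ q)
X ≟ᵖ X = yes refl
X ≟ᵖ O = no λ()
O ≟ᵖ X = no λ()
O ≟ᵖ O = yes refl

PartialTransversal : ℕ → List (Cell n) → Set
PartialTransversal m xs = ∃[ t ] ((length t ≡ m × AllPairs Apart t) × t ⊆ xs)

-- Guessing the first cell `c` leaves a shorter list to be found among the cells apart from `c`;
-- this recursion is why the length `m` is freed from the board size.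
partialTransversal? : ∀ m (xs : List (Cell n)) → Dec (PartialTransversal m xs)
partialTransversal? zero    xs = yes ([] , (refl , []) , λ ())
partialTransversal? (suc m) xs = map′ build split
  (any? (λ c → partialTransversal? m (filter (apart? c) xs)) xs)
  where
  build : Any (λ c → PartialTransversal m (filter (apart? c) xs)) xs →
          PartialTransversal (suc m) xs
  build found with find found
  ... | c , c∈xs , t , (eq , ps) , t⊆ =
    c ∷ t ,
    (cong suc eq , All.tabulate (proj₂ ∘ ∈-filter⁻ (apart? c) {xs = xs} ∘ t⊆) ∷ ps) ,
    λ { (here refl) → c∈xs ; (there d∈t) → proj₁ (∈-filter⁻ (apart? c) (t⊆ d∈t)) }

  split : PartialTransversal (suc m) xs →
          Any (λ c → PartialTransversal m (filter (apart? c) xs)) xs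
  split (c ∷ t , (eq , c# ∷ ps) , t⊆) =
    lose (t⊆ (here refl))
      (t , (suc-injective eq , ps) ,
       λ d∈t → ∈-filter⁺ (apart? c) (t⊆ (there d∈t)) (All.lookup c# d∈t))

owns? : ∀ p (h : History n) → Dec (OwnsTransversal p h)
owns? {n} p h = partialTransversal? n (cellsOf p h)

full? : (h : History n) → Dec (BoardFull h)
full? h = map′ uncurry (λ full i j → full (i , j))
  (allFin? λ i → allFin? λ j → (i , j) ∈? h)

over? : (h : History n) → Dec (Over h)
over? h = owns? X h ⊎-dec owns? O h ⊎-dec full? h

-- Refuting strategies by search.

-- A tree of play independent of any strategy: it branches over all legal moves of `p`, but fixes
-- one move for the opponent. A drawn leaf also foils `p`.
data Foiled (p : Player) {n : ℕ} : History n → Set where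
  over   : Over h → ¬ OwnsTransversal p h → Foiled p h
  theirs : ¬ Over h → toMove h ≡ p → (∀ c → c ∉ h → Foiled p (c ∷ h)) → Foiled p h
  ours   : ¬ Over h → toMove h ≢ p → ∀ c → c ∉ h → Foiled p (c ∷ h) → Foiled p h

-- `σ` selects a branch at each `theirs` node, its legality makes the cell fresh, and the leaf
-- reached contradicts `wins`.
foiled⇒¬winning : Foiled p {n} [] → ¬ HasWinningStrategy p n
foiled⇒¬winning {p = p} {n = n} foiled (σ , σ-wins) = go foiled start tt
  where
  open IsWinning σ-wins
  go : {h : History n} → Foiled p h → Play h → Follows p σ h → ⊥
  go (over o ¬own)         play follows = ¬own (wins _ play follows o)
  go (theirs ¬o turn next) play follows =
    go (next _ fresh) (move play ¬o fresh) ((λ _ → refl) , follows)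
    where fresh = legal _ play follows ¬o turn
  go (ours ¬o turn c fresh next) play follows =
    go next (move play ¬o fresh) ((λ eq → contradiction eq turn) , follows)

allOf : {P : Fin n → Set} → (∀ i → Maybe (P i)) → Maybe (∀ i → P i)
allOf {zero}  f = just λ ()
allOf {suc n} f with f zero | allOf (f ∘ suc)
... | just x  | just xs = just λ { zero → x ; (suc i) → xs i }
... | just _  | nothing = nothing
... | nothing | _       = nothing

anyOf : {A : Set} → (Fin n → Maybe A) → Maybe A
anyOf {zero}  f = nothing
anyOf {suc n} f = f zero <∣> anyOf (f ∘ suc)

-- Proof by computation: `from-just` can extract a tree only if the search evaluates to `just`. A
-- `nothing` asserts nothing, and also covers lack of fuel.
foil : ∀ (p : Player) → ℕ → (h : History n) → Maybe (Foiled p h)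
foil p zero    h = nothing
foil p (suc k) h with over? h
... | yes o with owns? p h
...   | yes _   = nothing
...   | no ¬own = just (over o ¬own)
foil p (suc k) h | no ¬o with toMove h ≟ᵖ p
...   | yes turn = Maybe.map (λ f → theirs ¬o turn λ (i , j) → f i j) (allOf λ i → allOf λ j → reply i j)
  where
  reply : ∀ i j → Maybe ((i , j) ∉ h → Foiled p ((i , j) ∷ h))
  reply i j with (i , j) ∈? h
  ... | yes c∈h = just λ c∉h → contradiction c∈h c∉h
  ... | no _    = Maybe.map const (foil p k _)
...   | no turn = anyOf λ i → anyOf λ j → try i j
  where
  try : ∀ i j → Maybe (Foiled p h)
  try i j with (i , j) ∈? h
  ... | yes _    = nothing
  ... | no fresh = Maybe.map (ours ¬o turn _ fresh) (foil p k _)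

-- From game trees to strategies.

Own : List (Cell n) → Set
Own xs = ∃[ t ] (IsTransversal t × t ⊆ xs)

-- The indices are the cells of X and those of O; X is to move in Winning, O in Answered.
data Winning (xs os : List (Cell n)) : Set
record Answered (xs os : List (Cell n)) : Set

data Winning xs os where
  claim : ∀ c → c ∉ xs → c ∉ os → Own (c ∷ xs) ⊎ Answered (c ∷ xs) os → Winning xs os

record Answered xs os where
  inductive
  field
    -- Excludes a full board after a move of X that has not yet won.
    free   : ∃[ d ] (d ∉ xs × d ∉ os)
    answer : ∀ d → d ∉ xs → d ∉ os → ¬ Own (d ∷ os) × Winning xs (d ∷ os)

open Answered

-- The tree over histories, from which a strategy can be read off; `Winning` sees only the two lists
-- of cells, on which symmetries act.
data WinningFrom (h : History n) : Set where
  claim : ∀ c → c ∉ h →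
          OwnsTransversal X (c ∷ h) ⊎
          (∃[ d ] (d ∉ c ∷ h)) ×
          (∀ d → d ∉ c ∷ h → ¬ OwnsTransversal O (d ∷ c ∷ h) × WinningFrom (d ∷ c ∷ h)) →
          WinningFrom h

cellsOf-mover : ∀ p (h : History n) {c} → toMove h ≡ p → cellsOf p (c ∷ h) ≡ c ∷ cellsOf p h
cellsOf-mover X h eq rewrite eq = refl
cellsOf-mover O h eq rewrite eq = refl

cellsOf-waiter : ∀ p (h : History n) {c} → toMove h ≡ opponent p → cellsOf p (c ∷ h) ≡ cellsOf p h
cellsOf-waiter X h eq rewrite eq = refl
cellsOf-waiter O h eq rewrite eq = refl

cellsOf-⊆ : ∀ p (h : History n) → cellsOf p h ⊆ h
cellsOf-⊆ p (c ∷ h) x∈ with p | toMove h | x∈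
... | X | X | here eq  = here eq
... | X | X | there x∈ = there (cellsOf-⊆ X h x∈)
... | O | O | here eq  = here eq
... | O | O | there x∈ = there (cellsOf-⊆ O h x∈)
... | X | O | x∈       = there (cellsOf-⊆ X h x∈)
... | O | X | x∈       = there (cellsOf-⊆ O h x∈)

∈-cellsOf : ∀ (h : History n) {c} → c ∈ h → c ∈ cellsOf X h ⊎ c ∈ cellsOf O h
∈-cellsOf (c ∷ h) c∈ with toMove h | c∈
... | X | here eq  = inj₁ (here eq)
... | O | here eq  = inj₂ (here eq)
... | X | there c∈ = Sum.map₁ there (∈-cellsOf h c∈)
... | O | there c∈ = Sum.map₂ there (∈-cellsOf h c∈)

∉-history : {c : Cell n} → c ∉ cellsOf X h → c ∉ cellsOf O h → c ∉ h
∉-history {h = h} c∉X c∉O = Sum.[ c∉X , c∉O ] ∘ ∈-cellsOf h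

-- The equations are hypotheses because `cellsOf` of an extended history reduces only once `toMove`
-- is known.
toHistory : {xs os : List (Cell n)} → toMove h ≡ X → cellsOf X h ≡ xs → cellsOf O h ≡ os →
            Winning xs os → WinningFrom h
toHistory {h = h} turn refl refl (claim c c∉X c∉O rest) = claim c (∉-history c∉X c∉O) (convert rest)
  where
  h′ = c ∷ h
  eqX : cellsOf X h′ ≡ c ∷ cellsOf X h
  eqX = cellsOf-mover X h turn
  eqO : cellsOf O h′ ≡ cellsOf O h
  eqO = cellsOf-waiter O h turn
  turn′ : toMove h′ ≡ O
  turn′ = cong opponent turn
  ∉-history′ : ∀ {d} → d ∉ c ∷ cellsOf X h → d ∉ cellsOf O h → d ∉ h′
  ∉-history′ d∉X d∉O = ∉-history (d∉X ∘ subst (_ ∈_) eqX) (d∉O ∘ subst (_ ∈_) eqO)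
  convert : Own (c ∷ cellsOf X h) ⊎ Answered (c ∷ cellsOf X h) (cellsOf O h) →
            OwnsTransversal X h′ ⊎
            (∃[ d ] (d ∉ h′)) ×
            (∀ d → d ∉ h′ → ¬ OwnsTransversal O (d ∷ h′) × WinningFrom (d ∷ h′))
  convert (inj₁ own) = inj₁ (subst Own (sym eqX) own)
  convert (inj₂ record { free = e , e∉X , e∉O ; answer = answer }) = inj₂ ((e , ∉-history′ e∉X e∉O) , reply)
    where
    reply : ∀ d → d ∉ h′ → ¬ OwnsTransversal O (d ∷ h′) × WinningFrom (d ∷ h′)
    reply d d∉ with answer d (d∉ ∘ cellsOf-⊆ X h′ ∘ subst (d ∈_) (sym eqX))
                             (d∉ ∘ cellsOf-⊆ O h′ ∘ subst (d ∈_) (sym eqO))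
    ... | ¬own , w = ¬own ∘ subst Own eqO′ , toHistory (cong opponent turn′) eqX′ eqO′ w
      where
      eqO′ = trans (cellsOf-mover O h′ turn′) (cong (d ∷_) eqO)
      eqX′ = trans (cellsOf-waiter X h′ turn′) eqX

next : WinningFrom h → Cell _
next (claim c _ _) = c

module Tracking (w₀ : WinningFrom {n} []) where

  advance : (d c : Cell n) → WinningFrom h → Maybe (WinningFrom (d ∷ c ∷ h))
  advance d c (claim c′ _ (inj₁ _)) = nothing
  advance {h = h} d c (claim c′ _ (inj₂ (_ , reply))) with c ≟ᶜ c′ | d ∈? (c′ ∷ h)
  ... | yes refl | no d∉ = just (proj₂ (reply d d∉))
  ... | yes _    | yes _ = nothing
  ... | no _     | _     = nothing

  -- A strategy sees only the history, so the tree is replayed along it, two moves at a time;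
  -- `nothing` marks histories with O to move or that leave the tree.
  track : (h : History n) → Maybe (WinningFrom h)
  track []          = just w₀
  track (c ∷ [])    = nothing
  track (d ∷ c ∷ h) = track h Maybe.>>= advance d c

  strategy : Strategy n
  -- The default `next w₀` is arbitrary: plays that follow the strategy never meet it when X is to
  -- move.
  strategy h = maybe next (next w₀) (track h)

  -- The invariant of plays following the strategy. After a move of X the tree kept is the one
  -- before it, whose `claim` tells whether X has just won.
  data Tracked : History n → Set where
    xTurn : toMove h ≡ X → (w : WinningFrom h) → track h ≡ just w →
            ¬ OwnsTransversal O h → Tracked h
    oTurn : toMove h ≡ X → (w : WinningFrom h) → track h ≡ just w →
            ¬ OwnsTransversal O h → Tracked (next w ∷ h)

  strategy-tracked : {w : WinningFrom h} → track h ≡ just w → strategy h ≡ next w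
  strategy-tracked eq = cong (maybe next (next w₀)) eq

  advance-next : ∀ {c d rest} (c∉ : c ∉ h) → d ∉ c ∷ h →
                 let w = claim {h = h} c c∉ (inj₂ rest) in
                 ∃[ d∉ ] advance d c w ≡ just (proj₂ (proj₂ rest d d∉))
  advance-next {h = h} {c} {d} c∉ d∉ with c ≟ᶜ c | d ∈? (c ∷ h)
  ... | yes refl | no d∉′ = d∉′ , refl
  ... | yes _    | yes d∈ = contradiction d∈ d∉
  ... | no c≢c   | _      = contradiction refl c≢c

  tracked : ¬ Own {n} [] → Play h → Follows X strategy h → Tracked h
  tracked ¬own₀ start _ = xTurn refl w₀ refl ¬own₀
  tracked ¬own₀ (move {c = c} play ¬over c∉) (follow , follows) with tracked ¬own₀ play follows
  ... | xTurn turn w eq ¬own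
        rewrite trans (follow turn) (strategy-tracked eq) = oTurn turn w eq ¬own
  ... | oTurn turn (claim b b∉ (inj₁ own)) eq ¬own = contradiction (inj₁ own) ¬over
  ... | oTurn {h = h} turn (claim b b∉ (inj₂ rest)) eq ¬own
        with advance-next {rest = rest} b∉ c∉
  ...   | c∉′ , eq′ = xTurn (cong (opponent ∘ opponent) turn) _
                        (trans (cong (Maybe._>>= advance c b) eq) eq′) (proj₁ (proj₂ rest c c∉′))

  strategy-wins : ¬ Own {n} [] → IsWinning X strategy
  strategy-wins ¬own₀ = record { legal = legal ; wins = wins }
    where
    legal : ∀ h → Play h → Follows X strategy h → ¬ Over h → toMove h ≡ X → strategy h ∉ h
    legal h play follows _ turn with tracked ¬own₀ play follows
    ... | xTurn _ w@(claim c c∉ _) eq _ = subst (_∉ h) (sym (strategy-tracked eq)) c∉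
    ... | oTurn turn′ _ _ _ rewrite turn′ with () ← turn
    wins : ∀ h → Play h → Follows X strategy h → Over h → OwnsTransversal X h
    wins h play follows end with tracked ¬own₀ play follows | end
    ... | _                                  | inj₁ own         = own
    ... | xTurn _ _ _ ¬own                   | inj₂ (inj₁ own)  = contradiction own ¬own
    ... | xTurn _ (claim c c∉ _) _ _         | inj₂ (inj₂ full) = contradiction (full c) c∉
    ... | oTurn {h = h} turn _ _ ¬own        | inj₂ (inj₁ own)  =
          contradiction (subst Own (cellsOf-waiter O h turn) own) ¬own
    ... | oTurn _ (claim _ _ (inj₁ own)) _ _ | inj₂ (inj₂ _)    = own
    ... | oTurn _ (claim _ _ (inj₂ ((d , d∉) , _))) _ _ | inj₂ (inj₂ full) =
          contradiction (full d) d∉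

winning⇒strategy : ¬ Own {n} [] → Winning {n} [] [] → HasWinningStrategy X n
winning⇒strategy ¬own w = strategy , strategy-wins ¬own
  where open Tracking (toHistory refl refl refl w)

-- Symmetries of the board.

-- Involutions suffice here, and being their own inverses they transfer facts back through the same
-- map.
record Symmetry (n : ℕ) : Set where
  field
    apply      : Cell n → Cell n
    involutive : ∀ c → apply (apply c) ≡ c
    apart      : ∀ {c d} → Apart c d → Apart (apply c) (apply d)

  map-involutive : ∀ xs → map apply (map apply xs) ≡ xs
  map-involutive xs = trans (sym (map-∘ xs)) (trans (map-cong involutive xs) (map-id xs))

  ∈-apply : ∀ {c xs} → apply c ∈ map apply xs → c ∈ xs
  ∈-apply {c} {xs} c∈ = subst₂ _∈_ (involutive c) (map-involutive xs) (∈-map⁺ apply c∈)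

  own-map : ∀ {xs} → Own xs → Own (map apply xs)
  own-map (t , (eq , ps) , t⊆) =
    map apply t ,
    (trans (length-map apply t) eq , AllPairs.map⁺ (AllPairs.map apart ps)) ,
    Subset.map⁺ apply t⊆

  own-unmap : ∀ {xs} → Own (map apply xs) → Own xs
  own-unmap = subst Own (map-involutive _) ∘ own-map

module _ (φ : Symmetry n) where
  open Symmetry φ

  -- X plays the image of the move prescribed in the mapped position, and O's moves are translated
  -- the other way.
  winning-unmap : ∀ {xs os xs′ os′} → xs′ ≡ map apply xs → os′ ≡ map apply os →
                  Winning xs′ os′ → Winning xs os
  answered-unmap : ∀ {xs os xs′ os′} → xs′ ≡ map apply xs → os′ ≡ map apply os →
                   Answered xs′ os′ → Answered xs os

  winning-unmap {xs} {os} refl refl (claim c c∉xs c∉os rest) =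
    claim (apply c) (c∉xs ∘ moved) (c∉os ∘ moved) (convert rest)
    where
    moved : ∀ {ys} → apply c ∈ ys → c ∈ map apply ys
    moved c∈ = subst (_∈ _) (involutive c) (∈-map⁺ apply c∈)
    eq : c ∷ map apply xs ≡ map apply (apply c ∷ xs)
    eq = cong (_∷ _) (sym (involutive c))
    convert : Own (c ∷ map apply xs) ⊎ Answered (c ∷ map apply xs) (map apply os) →
              Own (apply c ∷ xs) ⊎ Answered (apply c ∷ xs) os
    convert (inj₁ own) = inj₁ (own-unmap (subst Own eq own))
    convert (inj₂ a)   = inj₂ (answered-unmap eq refl a)

  answered-unmap refl refl record { free = (d , d∉xs , d∉os) } .free =
    apply d , d∉xs ∘ moved , d∉os ∘ moved
    where
    moved : ∀ {ys} → apply d ∈ ys → d ∈ map apply ys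
    moved d∈ = subst (_∈ _) (involutive d) (∈-map⁺ apply d∈)
  answered-unmap refl refl record { answer = answer } .answer d d∉xs d∉os
    with answer (apply d) (d∉xs ∘ ∈-apply) (d∉os ∘ ∈-apply)
  ... | ¬own , w = ¬own ∘ own-map , winning-unmap refl refl w

-- Transpositions of indices.

transpose-left : (i j : Fin n) → transpose i j i ≡ j
transpose-left i j rewrite dec-true (i ≟ᶠ i) refl = refl

transpose-right : (i j : Fin n) → transpose i j j ≡ i
transpose-right i j with j ≟ᶠ i
... | yes j≡i = j≡i
... | no _ rewrite dec-true (j ≟ᶠ j) refl = refl

transpose-other : {i j k : Fin n} → k ≢ i → k ≢ j → transpose i j k ≡ k
transpose-other {i = i} {j} {k} k≢i k≢j
  rewrite dec-false (k ≟ᶠ i) k≢i | dec-false (k ≟ᶠ j) k≢j = refl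

transpose-involutive : (i j k : Fin n) → transpose i j (transpose i j k) ≡ k
transpose-involutive i j k = by (k ≟ᶠ i) (k ≟ᶠ j)
  where
  by : Dec (k ≡ i) → Dec (k ≡ j) → transpose i j (transpose i j k) ≡ k
  by (yes refl) _          = trans (cong (transpose i j) (transpose-left i j)) (transpose-right i j)
  by (no _)     (yes refl) = trans (cong (transpose i j) (transpose-right i j)) (transpose-left i j)
  by (no k≢i)   (no k≢j)   = trans (cong (transpose i j) (transpose-other k≢i k≢j)) (transpose-other k≢i k≢j)

transpose-injective : (i j : Fin n) {k l : Fin n} → transpose i j k ≡ transpose i j l → k ≡ l
transpose-injective i j {k} {l} eq =
  trans (sym (transpose-involutive i j k))
    (trans (cong (transpose i j) eq) (transpose-involutive i j l))

-- Counting columns and building transversals.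

-- Pigeonhole: deleting `i` shortens `js` and, as `is` has no repetition, still leaves room for its
-- tail.
unique-⊆⇒length≤ : {is js : List (Fin n)} → Unique is → is ⊆ js → length is ≤ length js
unique-⊆⇒length≤ [] _ = z≤n
unique-⊆⇒length≤ {is = i ∷ is} {js} (i∉is ∷ unique) is⊆js =
  ≤-trans
    (s≤s (unique-⊆⇒length≤ unique λ j∈is →
      ∈-filter⁺ ≢i? (is⊆js (there j∈is)) (≢-sym (All.lookup i∉is j∈is))))
    (filter-notAll ≢i? js (lose (is⊆js (here refl)) λ i≢i → i≢i refl))
  where ≢i? = λ j → ¬? (j ≟ᶠ i)

missing : (is : List (Fin n)) → length is < n → ∃[ i ] i ∉ is
missing {n} is few = ¬∀⟶∃¬ n (_∈ is) (λ i → DecMembership._∈?_ _≟ᶠ_ i is) λ all∈ →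
  <⇒≱ few (subst (_≤ length is) (length-tabulate {n = n} (λ i → i))
    (unique-⊆⇒length≤ (allFin⁺ n) λ {i} _ → all∈ i))

-- A transversal meets `n` distinct columns. In the strategy for `n ≥ 4`, every proof that O has not
-- won rests on this count.
covered⇒¬own : {is : List (Fin n)} → (∀ {c} → c ∈ xs → col c ∈ is) → length is < n → ¬ Own xs
covered⇒¬own {is = is} covered few (t , (eq , apart) , t⊆xs) =
  <⇒≱ few (subst (_≤ length is) (trans (length-map col t) eq)
    (unique-⊆⇒length≤ (AllPairs.map⁺ (AllPairs.map proj₂ apart)) cols⊆))
  where
  cols⊆ : map col t ⊆ is
  cols⊆ j∈ with ∈-map⁻ col j∈
  ... | c , c∈t , refl = covered (t⊆xs c∈t)

graph⇒own : (f : Fin n → Fin n) → (∀ {i j} → f i ≡ f j → i ≡ j) → (∀ i → (i , f i) ∈ xs) → Own xs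
graph⇒own f injective graph⊆ =
  tabulate (λ i → i , f i) ,
  (length-tabulate _ , AllPairs.tabulate⁺ λ i≢j → i≢j , i≢j ∘ injective) ,
  λ c∈ → graph∈ (∈-tabulate⁻ c∈)
  where
  graph∈ : ∀ {c} → ∃[ i ] c ≡ (i , f i) → c ∈ _
  graph∈ (i , refl) = graph⊆ i

-- The diagonal with `u` and `v` exchanged; `u ≡ v` is allowed and gives the diagonal itself.
transposition⇒own : {u v : Fin n} → (u , v) ∈ xs → (v , u) ∈ xs →
                    (∀ i → i ≢ u → i ≢ v → (i , i) ∈ xs) → Own xs
transposition⇒own {n} {xs} {u} {v} uv∈ vu∈ rest∈ =
  graph⇒own (transpose u v) (transpose-injective u v) graph⊆
  where
  graph⊆ : ∀ i → (i , transpose u v i) ∈ xs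
  graph⊆ i = by (i ≟ᶠ u) (i ≟ᶠ v)
    where
    by : Dec (i ≡ u) → Dec (i ≡ v) → (i , transpose u v i) ∈ xs
    by (yes refl) _          rewrite transpose-left u v      = uv∈
    by (no _)     (yes refl) rewrite transpose-right u v     = vu∈
    by (no i≢u)   (no i≢v)   rewrite transpose-other i≢u i≢v = rest∈ i i≢u i≢v

threeCycle⇒own : {u v w : Fin n} → v ≢ u → w ≢ u → w ≢ v →
                 (u , v) ∈ xs → (v , w) ∈ xs → (w , u) ∈ xs →
                 (∀ i → i ≢ u → i ≢ v → i ≢ w → (i , i) ∈ xs) → Own xs
threeCycle⇒own {n} {xs} {u} {v} {w} v≢u w≢u w≢v uv∈ vw∈ wu∈ rest∈ =
  graph⇒own f (transpose-injective u v ∘ transpose-injective u w) graph⊆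
  where
  f : Fin n → Fin n
  -- Sends `u` to `v`, `v` to `w` and `w` to `u`.
  f i = transpose u w (transpose u v i)
  graph⊆ : ∀ i → (i , f i) ∈ xs
  graph⊆ i = by (i ≟ᶠ u) (i ≟ᶠ v) (i ≟ᶠ w)
    where
    by : Dec (i ≡ u) → Dec (i ≡ v) → Dec (i ≡ w) → (i , f i) ∈ xs
    by (yes refl) _ _
      rewrite transpose-left u v | transpose-other v≢u (≢-sym w≢v) = uv∈
    by (no _) (yes refl) _
      rewrite transpose-right u v | transpose-left u w = vw∈
    by (no _) (no _) (yes refl)
      rewrite transpose-other w≢u w≢v | transpose-right u w = wu∈
    by (no i≢u) (no i≢v) (no i≢w)
      rewrite transpose-other i≢u i≢v | transpose-other i≢u i≢w = rest∈ i i≢u i≢v i≢w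

-- Relabelling lines to keep X's cells on the diagonal.

transposed : Symmetry n
transposed = record
  { apply      = swap
  ; involutive = λ _ → refl
  ; apart      = swap
  }

-- Serves to move `(i , j)` to `(m , m)`.
relabelled : (i j m : Fin n) → Symmetry n
relabelled i j m = record
  { apply      = λ c → transpose i m (row c) , transpose j m (col c)
  ; involutive = λ c → cong₂ _,_ (transpose-involutive i m _) (transpose-involutive j m _)
  ; apart      = λ (r , c) → r ∘ transpose-injective i m , c ∘ transpose-injective j m
  }

open Symmetry using (apply)

Below : ℕ → Fin n → Set
Below k i = toℕ i < k

_∖_ : (Fin n → Set) → Fin n → Fin n → Set
(P ∖ i) j = P j × j ≢ i

module _ {k : ℕ} {m : Fin n} (m≡k : toℕ m ≡ k) where

  -- As `m` is the last line below `suc k`, exchanging it with `i` closes the gap left by removing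
  -- `i`; `unshrink` is the converse.
  shrink : ∀ {i} → Below (suc k) i → ∀ {j} → (Below (suc k) ∖ i) j → Below k (transpose i m j)
  shrink {i} i<1+k {j} (j<1+k , j≢i) = by (j ≟ᶠ m)
    where
    by : Dec (j ≡ m) → Below k (transpose i m j)
    by (yes refl) rewrite transpose-right i m = ≤∧≢⇒< (m<1+n⇒m≤n i<1+k) λ i≡k →
      j≢i (toℕ-injective (trans m≡k (sym i≡k)))
    by (no j≢m) rewrite transpose-other j≢i j≢m = ≤∧≢⇒< (m<1+n⇒m≤n j<1+k) λ j≡k →
      j≢m (toℕ-injective (trans j≡k (sym m≡k)))

  unshrink : ∀ {i j} → Below k (transpose i m j) → (Below (suc k) ∖ i) j
  unshrink {i} {j} τj<k = below (j ≟ᶠ i) (j ≟ᶠ m) , λ { refl → j≢i τj<k }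
    where
    j≢i : ¬ Below k (transpose i m i)
    j≢i rewrite transpose-left i m = λ m<k → <⇒≢ m<k m≡k
    below : Dec (j ≡ i) → Dec (j ≡ m) → Below (suc k) j
    below (yes refl) _          = contradiction τj<k j≢i
    below (no _)     (yes refl) = subst (_< suc k) (sym m≡k) (n<1+n k)
    below (no j≢i)   (no j≢m)   = m<n⇒m<1+n (subst (Below k) (transpose-other j≢i j≢m) τj<k)

record Diagonal {n} (k : ℕ) (xs : List (Cell n)) : Set where
  field
    diagonal : ∀ {c} → c ∈ xs → row c ≡ col c × ¬ Below k (row c)
    complete : ∀ i → ¬ Below k i → (i , i) ∈ xs

open Diagonal

-- R and C are the rows and columns not yet matched by X. All cells of O but at most
-- one avoid them, and the exceptional cell (a , z) blocks only a column. As lines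
-- contains the unmatched column z, a later cell of O in that column costs O a tempo.
record Confined {n} (R C : Fin n → Set) (b : ℕ) (os : List (Cell n)) : Set where
  field
    a z     : Fin n
    z∈C     : C z
    lines   : List (Fin n)
    few     : length lines ≤ b
    z∈lines : z ∈ lines
    covers  : ∀ {c} → c ∈ os → col c ∈ lines
    rows    : ∀ {c} → c ∈ os → ¬ R (row c)
    cols    : ∀ {c} → c ∈ os → ¬ C (col c) ⊎ c ≡ (a , z)

open Confined

-- The new cell lands on `(m , m)`, while the older ones stay fixed because `i`, `j` and `m` all lie
-- below `suc k`.
diagonal-claim : ∀ {k i j m} → toℕ m ≡ k → Below (suc k) i → Below (suc k) j →
                 Diagonal {n} (suc k) xs →
                 Diagonal k (map (apply (relabelled i j m)) ((i , j) ∷ xs))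
diagonal-claim {n} {xs} {k} {i} {j} {m} m≡k i< j< diag = record { diagonal = on ; complete = all }
  where
  φ = apply (relabelled i j m)
  m≮k : ¬ Below k m
  m≮k m<k = <⇒≢ m<k m≡k
  fixed : ∀ {u} → ¬ Below (suc k) u → φ (u , u) ≡ (u , u)
  fixed {u} u≮ = cong₂ _,_ (transpose-other (avoid i<) (avoid m<)) (transpose-other (avoid j<) (avoid m<))
    where
    m< : Below (suc k) m
    m< = subst (_< suc k) (sym m≡k) (n<1+n k)
    avoid : ∀ {v} → Below (suc k) v → u ≢ v
    avoid v< refl = u≮ v<
  head : φ (i , j) ≡ (m , m)
  head = cong₂ _,_ (transpose-left i m) (transpose-left j m)
  OnDiagonal : Cell n → Set
  OnDiagonal c = row c ≡ col c × ¬ Below k (row c)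
  on : ∀ {c} → c ∈ map φ ((i , j) ∷ xs) → OnDiagonal c
  on (here refl) = subst OnDiagonal (sym head) (refl , m≮k)
  on (there c∈) with ∈-map⁻ φ c∈
  ... | (u , v) , uv∈ , refl with diagonal diag uv∈
  ...   | refl , u≮ = subst OnDiagonal (sym (fixed u≮)) (refl , u≮ ∘ m<n⇒m<1+n)
  all : ∀ u → ¬ Below k u → (u , u) ∈ map φ ((i , j) ∷ xs)
  all u u≮ with u ≟ᶠ m
  ... | yes refl = here (sym head)
  ... | no u≢m   = there (subst (_∈ map φ xs) (fixed u≮′) (∈-map⁺ φ (complete diag u u≮′)))
    where
    u≮′ : ¬ Below (suc k) u
    u≮′ u<1+k = u≮ (≤∧≢⇒< (m<1+n⇒m≤n u<1+k) λ u≡k → u≢m (toℕ-injective (trans u≡k (sym m≡k))))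

confined-relabel : ∀ {k b i j m} → toℕ m ≡ k → Below (suc k) j →
                   Confined {n} (Below (suc k) ∖ i) (Below (suc k) ∖ j) b os →
                   Confined (Below k) (Below k) b (map (apply (relabelled i j m)) os)
confined-relabel {n} {os} {k} {i = i} {j} {m} m≡k j< conf = record
  { a       = transpose i m (a conf)
  ; z       = transpose j m (z conf)
  ; z∈C     = shrink m≡k j< (z∈C conf)
  ; lines   = map (transpose j m) (lines conf)
  ; few     = subst (_≤ _) (sym (length-map _ (lines conf))) (few conf)
  ; z∈lines = ∈-map⁺ _ (z∈lines conf)
  ; covers  = λ c∈ → covers′ (∈-map⁻ φ c∈)
  ; rows    = λ c∈ → rows′ (∈-map⁻ φ c∈)
  ; cols    = λ c∈ → cols′ (∈-map⁻ φ c∈)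
  }
  where
  φ = apply (relabelled i j m)
  covers′ : ∀ {c} → ∃[ d ] (d ∈ os × c ≡ φ d) → col c ∈ map (transpose j m) (lines conf)
  covers′ (d , d∈ , refl) = ∈-map⁺ _ (covers conf d∈)
  rows′ : ∀ {c} → ∃[ d ] (d ∈ os × c ≡ φ d) → ¬ Below k (row c)
  rows′ (d , d∈ , refl) = rows conf d∈ ∘ unshrink m≡k
  cols′ : ∀ {c} → ∃[ d ] (d ∈ os × c ≡ φ d) → ¬ Below k (col c) ⊎ c ≡ φ (a conf , z conf)
  cols′ (d , d∈ , refl) = Sum.map (_∘ unshrink m≡k) (cong φ) (cols conf d∈)

-- The exceptional cell may block a row instead; then the reflected position is confined.
Confined± : {n : ℕ} (R C : Fin n → Set) (b : ℕ) (os : List (Cell n)) → Set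
Confined± R C b os = Confined R C b os ⊎ Confined C R b (map swap os)

confined±-relabel : ∀ {k b i j m} → toℕ m ≡ k → Below (suc k) i → Below (suc k) j →
                    Confined± {n} (Below (suc k) ∖ i) (Below (suc k) ∖ j) b os →
                    Confined± (Below k) (Below k) b (map (apply (relabelled i j m)) os)
confined±-relabel m≡k i< j< (inj₁ conf) = inj₁ (confined-relabel m≡k j< conf)
confined±-relabel {os = os} {k} {b} m≡k i< j< (inj₂ conf) =
  -- Reflecting after relabelling by `i`, `j` equals relabelling by `j`, `i` after reflecting.
  inj₂ (subst (Confined _ _ b) (trans (sym (map-∘ os)) (map-∘ os)) (confined-relabel m≡k i< conf))

-- The reply of X in the greedy phase.

∉-∷ : {c d : Cell n} → c ≢ d → c ∉ os → c ∉ d ∷ os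
∉-∷ c≢d c∉ (here c≡d) = c≢d c≡d
∉-∷ c≢d c∉ (there c∈) = c∉ c∈

another : (i : Fin (2 + n)) → ∃[ j ] Below (2 + k) j × j ≢ i
another zero    = suc zero , s<s z<s , λ ()
another (suc i) = zero , z<s , λ ()

∉-diagonal : ∀ {i j} → Diagonal {n} k xs → Below k i → (i , j) ∉ xs
∉-diagonal diag i< ij∈ = proj₂ (diagonal diag ij∈) i<

diagonal-swap : Diagonal {n} k xs → Diagonal k (map swap xs)
diagonal-swap {n} {k} {xs} diag = record { diagonal = on ; complete = λ i → ∈-map⁺ swap ∘ complete diag i }
  where
  on : ∀ {c} → c ∈ map swap xs → row c ≡ col c × ¬ Below k (row c)
  on c∈ with ∈-map⁻ swap c∈
  ... | (i , j) , ij∈ , refl with diagonal diag ij∈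
  ...   | refl , i≮ = refl , i≮

-- A move `(i , j)` of X, described before relabelling: it removes row `i` and column `j` from the
-- unmatched lines.
Response : {n : ℕ} → ℕ → ℕ → List (Cell n) → Set
Response k b os = ∃[ i ] ∃[ j ] Below k i × Below k j × (i , j) ∉ os ×
  Confined± (Below k ∖ i) (Below k ∖ j) b os

absorb : ∀ k (x : Fin (suc n)) → ∃[ i ] Below (suc k) i × ¬ (Below (suc k) ∖ i) x
absorb k x with toℕ x <? suc k
... | yes x< = x , x< , λ (_ , x≢x) → x≢x refl
... | no x≮  = zero , z<s , λ (x< , _) → x≮ x<

-- X's row can neutralise the new cell `d` and X's column the old exceptional cell, so at most one
-- defect survives. The bound on `length os` serves the case where rows take over from columns.
respond : ∀ {os : List (Cell (2 + n))} → length os ≤ b →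
          Confined (Below (2 + k)) (Below (2 + k)) b os →
          ∀ d → Response (2 + k) (suc b) (d ∷ os)
respond {n = n} {b = b} {k = k} {os = os} len conf d@(x , y) = by (y ≟ᶠ z₀) (toℕ y <? K) (toℕ x <? K)
  where
  K = 2 + k
  z₀ = z conf
  a₀ = a conf

  fresh : ∀ {i j} → Below K i → (i , j) ≢ d → (i , j) ∉ d ∷ os
  fresh i< ≢d = ∉-∷ ≢d λ ij∈ → rows conf ij∈ i<

  rows∖ : ∀ i → ¬ (Below K ∖ i) x → ∀ {c} → c ∈ d ∷ os → ¬ (Below K ∖ i) (row c)
  rows∖ i x≮ (here refl) = x≮
  rows∖ i x≮ (there c∈)  = rows conf c∈ ∘ proj₁

  cols∖z : ∀ {c} → c ∈ os → ¬ (Below K ∖ z₀) (col c)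
  cols∖z c∈ (c< , c≢z) with cols conf c∈
  ... | inj₁ c≮   = c≮ c<
  ... | inj₂ refl = c≢z refl

  covers-∷ : ∀ {c} → c ∈ d ∷ os → col c ∈ y ∷ lines conf
  covers-∷ (here refl) = here refl
  covers-∷ (there c∈)  = there (covers conf c∈)

  by : Dec (y ≡ z₀) → Dec (Below K y) → Dec (Below K x) → Response K (suc b) (d ∷ os)
  -- Column `z₀` is in `lines` already, so once X matches it the place gained goes to a column `w`
  -- without cells of O.
  by (yes refl) _ (no x≮) with another {k = k} z₀
  ... | w , w< , w≢z = zero , z₀ , z<s , z∈C conf , fresh z<s (λ { refl → x≮ z<s }) , inj₁ record
    { a       = a₀
    ; z       = w
    ; z∈C     = w< , w≢z
    ; lines   = w ∷ lines conf
    ; few     = s≤s (few conf)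
    ; z∈lines = here refl
    ; covers  = λ { (here refl) → there (z∈lines conf) ; (there c∈) → there (covers conf c∈) }
    ; rows    = rows∖ zero (x≮ ∘ proj₁)
    ; cols    = λ { (here refl) → inj₁ λ (_ , z≢z) → z≢z refl ; (there c∈) → inj₁ (cols∖z c∈) }
    }
  -- X matches `z₀` in another row, leaving `d` to block row `x`; rows and columns exchange roles.
  by (yes refl) _ (yes x<) with another {k = k} x
  ... | i , i< , i≢x = i , z₀ , i< , z∈C conf , fresh i< (i≢x ∘ cong row) , inj₂ record
    { a       = z₀
    ; z       = x
    ; z∈C     = x< , ≢-sym i≢x
    -- Counted afresh: one row per cell of O, hence at most `suc b`.
    ; lines   = map col (map swap (d ∷ os))
    ; few     = s≤s (subst (_≤ b) (sym (trans (length-map col (map swap os)) (length-map swap os))) len)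
    ; z∈lines = here refl
    ; covers  = ∈-map⁺ col
    ; rows    = rows′ ∘ ∈-map⁻ swap
    ; cols    = cols′ ∘ ∈-map⁻ swap
    }
    where
    rows′ : ∀ {c} → ∃[ e ] (e ∈ d ∷ os × c ≡ swap e) → ¬ (Below K ∖ z₀) (row c)
    rows′ (_ , here refl , refl) (_ , z≢z) = z≢z refl
    rows′ (_ , there e∈  , refl)           = cols∖z e∈
    cols′ : ∀ {c} → ∃[ e ] (e ∈ d ∷ os × c ≡ swap e) → ¬ (Below K ∖ i) (col c) ⊎ c ≡ (z₀ , x)
    cols′ (_ , here refl , refl) = inj₂ refl
    cols′ (_ , there e∈  , refl) = inj₁ (rows conf e∈ ∘ proj₁)
  -- X matches `z₀`, in row `x` if that is unmatched, and `d` becomes the exceptional cell.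
  by (no y≢z) (yes y<) _ with absorb (suc k) x
  ... | i , i< , x≮ = i , z₀ , i< , z∈C conf , fresh i< (y≢z ∘ sym ∘ cong col) , inj₁ record
    { a       = x
    ; z       = y
    ; z∈C     = y< , y≢z
    ; lines   = y ∷ lines conf
    ; few     = s≤s (few conf)
    ; z∈lines = here refl
    ; covers  = covers-∷
    ; rows    = rows∖ i x≮
    ; cols    = λ { (here refl) → inj₂ refl ; (there c∈) → inj₁ (cols∖z c∈) }
    }
  -- `d` blocks no unmatched column, so `z₀` is kept and X matches another column.
  by (no y≢z) (no y≮) _ with absorb (suc k) x | another {k = k} z₀
  ... | i , i< , x≮ | j , j< , j≢z = i , j , i< , j< , fresh i< (λ { refl → y≮ j< }) , inj₁ record
    { a       = a₀
    ; z       = z₀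
    ; z∈C     = z∈C conf , ≢-sym j≢z
    ; lines   = y ∷ lines conf
    ; few     = s≤s (few conf)
    ; z∈lines = there (z∈lines conf)
    ; covers  = covers-∷
    ; rows    = rows∖ i x≮
    ; cols    = λ { (here refl) → inj₁ (y≮ ∘ proj₁) ; (there c∈) → Sum.map₁ (_∘ proj₁) (cols conf c∈) }
    }

-- The endgame with one unmatched row and column.

below1 : {i : Fin (suc n)} → i ≢ zero → ¬ Below 1 i
below1 {i = zero}  i≢0 _          = i≢0 refl
below1 {i = suc i} _   (s≤s ())

endgame : ∀ {xs os : List (Cell (4 + n))} → b + 2 ≤ 4 + n → length os ≤ b →
          Diagonal 1 xs → Confined (Below 1) (Below 1) b os → Answered xs os
endgame {n = n} {b = b} {xs = xs} {os = os} b+2≤n len diag conf = record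
  { free   = (zero , zero) , ∉-diagonal diag z<s , outside z<s
  ; answer = λ d d∉xs d∉os → covered⇒¬own (covers₁ d) few₁ , by d (d ≟ᶜ (zero , zero))
  }
  where
  N = 4 + n
  z≡0 : z conf ≡ zero
  z≡0 with z conf | z∈C conf
  ... | zero  | _      = refl
  ... | suc _ | s≤s ()

  outside : ∀ {i j} → Below 1 i → (i , j) ∉ os
  outside i< ij∈ = rows conf ij∈ i<

  room : 2 + b ≤ N
  room = subst (_≤ N) (+-comm b 2) b+2≤n

  few₁ : 2 + length (lines conf) ≤ N
  few₁ = ≤-trans (s≤s (s≤s (few conf))) room

  covers₁ : ∀ d {c} → c ∈ d ∷ os → col c ∈ col d ∷ lines conf
  covers₁ d (here refl) = here refl
  covers₁ d (there c∈)  = there (covers conf c∈)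

  -- O's forced reply (zero , zero) lies in a column counted already.
  covers₂ : ∀ {c} → c ∈ (zero , zero) ∷ os → col c ∈ lines conf
  covers₂ (here refl) = subst (_∈ lines conf) z≡0 (z∈lines conf)
  covers₂ (there c∈)  = covers conf c∈

  covers₃ : ∀ d {c} → c ∈ d ∷ (zero , zero) ∷ os → col c ∈ col d ∷ lines conf
  covers₃ d (here refl) = here refl
  covers₃ d (there c∈)  = there (covers₂ c∈)

  off-zero : ∀ {i j} → i ≢ j → (i , j) ∉ xs
  off-zero i≢j ij∈ = i≢j (proj₁ (diagonal diag ij∈))

  block : Winning xs ((zero , zero) ∷ os)
  -- O has at most `suc b` cells, fewer than there are rows.
  block with missing (map row ((zero , zero) ∷ os))
    (≤-trans (s≤s (s≤s (subst (_≤ b) (sym (length-map row os)) len))) room)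
  -- Size at least four is needed here: `w` must also avoid the row `a conf` of the one older cell
  -- that may lie in column `zero`.
  ... | u , u∉ with missing (zero ∷ u ∷ a conf ∷ []) (s≤s (s≤s (s≤s (s≤s z≤n))))
  ...   | w , w∉ = claim (zero , u) (∉-diagonal diag z<s) (∉-∷ (u≢0 ∘ cong col) (outside z<s)) (inj₂ record
    { free   = (u , zero) , ∉-∷ (u≢0 ∘ cong row) (off-zero u≢0) , u-free
    ; answer = λ e _ _ → covered⇒¬own (covers₃ e) few₁ , threat e (e ≟ᶜ (u , zero))
    })
    where
    u≢0 : u ≢ zero
    u≢0 refl = u∉ (here refl)
    w≢0 : w ≢ zero
    w≢0 refl = w∉ (here refl)
    w≢u : w ≢ u
    w≢u refl = w∉ (there (here refl))
    w≢a : w ≢ a conf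
    w≢a refl = w∉ (there (there (here refl)))

    u-free : ∀ {j} → (u , j) ∉ (zero , zero) ∷ os
    u-free c∈ = u∉ (∈-map⁺ row c∈)

    threat : ∀ e → Dec (e ≡ (u , zero)) → Winning ((zero , u) ∷ xs) (e ∷ (zero , zero) ∷ os)
    threat e (no e≢) =
      claim (u , zero) (∉-∷ (u≢0 ∘ cong row) (off-zero u≢0)) (∉-∷ (≢-sym e≢) u-free)
        (inj₁ (transposition⇒own (there (here refl)) (here refl)
          λ i i≢0 _ → there (there (complete diag i (below1 i≢0)))))
    threat _ (yes refl) = claim (w , zero)
      (∉-∷ (w≢0 ∘ cong row) (off-zero w≢0))
      (∉-∷ (w≢u ∘ cong row) (∉-∷ (w≢0 ∘ cong row) w-free))
      (inj₂ record
        { free   = (zero , w) ,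
                   ∉-∷ (≢-sym w≢0 ∘ cong row) (∉-∷ (w≢u ∘ cong col) (off-zero (≢-sym w≢0))) ,
                   ∉-∷ (≢-sym u≢0 ∘ cong row) (∉-∷ (w≢0 ∘ cong col) (outside z<s))
        ; answer = λ f _ _ → covered⇒¬own (covers₄ f) few₁ , double f (f ≟ᶜ (zero , w))
        })
      where
      w-free : (w , zero) ∉ os
      w-free c∈ with cols conf c∈
      ... | inj₁ 0≮ = 0≮ z<s
      ... | inj₂ eq = w≢a (cong row eq)

      covers₄ : ∀ f {c} → c ∈ f ∷ (u , zero) ∷ (zero , zero) ∷ os → col c ∈ col f ∷ lines conf
      covers₄ f (here refl)         = here refl
      covers₄ f (there (here refl)) = there (covers₂ (here refl))
      covers₄ f (there (there c∈))  = there (covers₂ c∈)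

      double : ∀ f → Dec (f ≡ (zero , w)) →
               Winning ((w , zero) ∷ (zero , u) ∷ xs) (f ∷ (u , zero) ∷ (zero , zero) ∷ os)
      double f (no f≢) = claim (zero , w)
        (∉-∷ (≢-sym w≢0 ∘ cong row) (∉-∷ (w≢u ∘ cong col) (off-zero (≢-sym w≢0))))
        (∉-∷ (≢-sym f≢) (∉-∷ (≢-sym u≢0 ∘ cong row) (∉-∷ (w≢0 ∘ cong col) (outside z<s))))
        (inj₁ (transposition⇒own (here refl) (there (here refl))
          λ i i≢0 _ → there (there (there (complete diag i (below1 i≢0))))))
      double _ (yes refl) = claim (u , w)
        (∉-∷ (≢-sym w≢u ∘ cong row) (∉-∷ (u≢0 ∘ cong row) (off-zero (≢-sym w≢u))))
        (∉-∷ (u≢0 ∘ cong row) (∉-∷ (w≢0 ∘ cong col) u-free))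
        (inj₁ (threeCycle⇒own u≢0 w≢0 w≢u
          (there (there (here refl))) (here refl) (there (here refl))
          λ i i≢0 _ _ → there (there (there (complete diag i (below1 i≢0))))))

  by : ∀ d → Dec (d ≡ (zero , zero)) → Winning xs (d ∷ os)
  by _ (yes refl) = block
  by d (no d≢)    = claim (zero , zero) (∉-diagonal diag z<s) (∉-∷ (≢-sym d≢) (outside z<s))
    (inj₁ (transposition⇒own {u = zero} {v = zero} (here refl) (here refl)
      λ i i≢0 _ → there (complete diag i (below1 i≢0))))

-- Induction on the number of unmatched lines.

-- Each round raises `b` and lowers `k` by one, preserving the bound, which ensures that `b` lines
-- and one more are too few for a transversal of O.
answered± : ∀ k {b} {xs os : List (Cell (4 + n))} → b + (2 + k) ≤ 4 + n → length os ≤ b →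
            Diagonal (suc k) xs → Confined± (Below (suc k)) (Below (suc k)) b os → Answered xs os

answered : ∀ k {b} {xs os : List (Cell (4 + n))} → b + (2 + k) ≤ 4 + n → length os ≤ b →
           Diagonal (suc k) xs → Confined (Below (suc k)) (Below (suc k)) b os → Answered xs os

winning : ∀ k {b} {xs os : List (Cell (4 + n))} → b + (2 + k) ≤ 4 + n → length os ≤ b →
          Diagonal (2 + k) xs → Response (2 + k) b os → Winning xs os

answered± k bound len diag (inj₁ conf) = answered k bound len diag conf
answered± k {os = os} bound len diag (inj₂ conf) =
  answered-unmap transposed refl refl
    (answered k bound (subst (_≤ _) (sym (length-map swap os)) len) (diagonal-swap diag) conf)

answered zero    bound len diag conf = endgame bound len diag conf
answered {n = n} (suc k) {b} {xs} {os} bound len diag conf = record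
  { free   = (zero , zero) , ∉-diagonal diag z<s , λ c∈ → rows conf c∈ z<s
  ; answer = λ d d∉xs d∉os →
      covered⇒¬own {is = col d ∷ lines conf}
        (λ { (here refl) → here refl ; (there c∈) → there (covers conf c∈) })
        (≤-trans (s≤s (s≤s (few conf))) (≤-trans (s≤s (s≤s (m≤m+n b (suc k)))) bound′)) ,
      winning k (subst (_≤ 4 + n) (+-suc b (2 + k)) bound) (s≤s len) diag (respond len conf d)
  }
  where
  bound′ : 2 + (b + suc k) ≤ 4 + n
  bound′ = subst (_≤ 4 + n) (trans (+-suc b (2 + k)) (cong suc (+-suc b (suc k)))) bound

winning {n = n} k {b} {os = os} bound len diag (i , j , i< , j< , ij∉os , conf) =
  claim (i , j) (∉-diagonal diag i<) ij∉os (inj₂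
    (answered-unmap (relabelled i j m) refl refl
      (answered± k bound (subst (_≤ b) (sym (length-map _ os)) len)
        (diagonal-claim m≡k i< j< diag)
        (confined±-relabel m≡k i< j< conf))))
  where
  1+k<n : suc k < 4 + n
  1+k<n = ≤-trans (m≤n+m (2 + k) b) bound
  m : Fin (4 + n)
  -- The last unmatched line, next to join the diagonal.
  m = fromℕ< 1+k<n
  m≡k : toℕ m ≡ suc k
  m≡k = toℕ-fromℕ< 1+k<n

-- The opening and the individual board sizes.

-- X opens in the last corner. O's first cell is off its column, up to reflection, and becomes the
-- exceptional cell.
first-player-wins : ∀ n → Winning {4 + n} [] []
first-player-wins n = claim (m , m) (λ ()) (λ ()) (inj₂ record
  { free   = (zero , zero) , (λ { (here ()) ; (there ()) }) , (λ ())
  ; answer = λ d d∉ _ →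
      covered⇒¬own {is = col d ∷ []} (λ { (here refl) → here refl }) (s≤s (s≤s z≤n)) ,
      second d d∉
  })
  where
  m : Fin (4 + n)
  m = fromℕ (3 + n)

  ≢m⇒< : ∀ {i} → i ≢ m → Below (3 + n) i
  ≢m⇒< {i} i≢m = ≤∧≢⇒< (toℕ≤pred[n] i) λ eq → i≢m (toℕ-injective (trans eq (sym (toℕ-fromℕ (3 + n)))))

  diag : Diagonal (3 + n) ((m , m) ∷ [])
  diag = record
    { diagonal = λ { (here refl) → refl , λ m< → <⇒≢ m< (toℕ-fromℕ (3 + n)) }
    ; complete = λ i i≮ → by i i≮ (i ≟ᶠ m)
    }
    where
    by : ∀ i → ¬ Below (3 + n) i → Dec (i ≡ m) → (i , i) ∈ (m , m) ∷ []
    by i _  (yes refl) = here refl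
    by i i≮ (no i≢m)   = contradiction (≢m⇒< i≢m) i≮

  below : ∀ x {y} → y ≢ m → Winning ((m , m) ∷ []) ((x , y) ∷ [])
  below x {y} y≢m with absorb (2 + n) x | another {k = suc n} y
  -- The bound starts as an equality: `1 + (2 + suc n)` is `4 + n`.
  ... | i , i< , x≮ | j , j< , j≢y = winning (suc n) {b = 1} ≤-refl ≤-refl diag
    (i , j , i< , j< , ∉-∷ (j≢y ∘ cong col) (λ ()) , inj₁ record
      { a       = x
      ; z       = y
      ; z∈C     = ≢m⇒< y≢m , ≢-sym j≢y
      ; lines   = y ∷ []
      ; few     = ≤-refl
      ; z∈lines = here refl
      ; covers  = λ { (here refl) → here refl }
      ; rows    = λ { (here refl) → x≮ }
      ; cols    = λ { (here refl) → inj₂ refl }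
      })

  second : ∀ d → d ∉ (m , m) ∷ [] → Winning ((m , m) ∷ []) (d ∷ [])
  second (x , y) d∉ with y ≟ᶠ m | x ≟ᶠ m
  ... | no y≢m   | _        = below x y≢m
  ... | yes _    | no x≢m   = winning-unmap transposed refl refl (below y x≢m)
  ... | yes refl | yes refl = contradiction (here refl) d∉

-- False for size zero, where the empty list is a transversal.
¬own-[] : ¬ Own {suc n} []
¬own-[] = covered⇒¬own {is = []} (λ ()) z<s

win₁ : HasWinningStrategy X 1
win₁ = winning⇒strategy ¬own-[] (claim (zero , zero) (λ ()) (λ ())
  (inj₁ (graph⇒own (λ i → i) (λ eq → eq) λ { zero → here refl ; (suc ()) })))

win₄₊ : (n : ℕ) → n ≥ 4 → HasWinningStrategy X n
win₄₊ _ (s≤s (s≤s (s≤s (s≤s {n = n} _)))) = winning⇒strategy ¬own-[] (first-player-wins n)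

-- The fuel exceeds the number of cells, the length of the longest play.
draw₂ : IsDraw 2
draw₂ = foiled⇒¬winning (from-just (foil {2} X 5 [])) , foiled⇒¬winning (from-just (foil {2} O 5 []))

draw₃ : IsDraw 3
draw₃ = foiled⇒¬winning (from-just (foil {3} X 10 [])) , foiled⇒¬winning (from-just (foil {3} O 10 []))

theoremA : HasWinningStrategy X 1 ×
    ((n : ℕ) → n ≥ 4 → HasWinningStrategy X n) ×
    IsDraw 2 ×
    IsDraw 3
theoremA = win₁ , win₄₊ , draw₂ , draw₃
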